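{- Let ${}^*\mathbb{Z}=\mathbb{Z}^I/\mathcal{U}$ be an ultrapower of $\mathbb{Z}$ with respect to a nonprincipal ultrafilter $\mathcal{U}$ on a countably infinite set $I$, and let $\mathfrak{m}$ be a maximal ideal of ${}^*\mathbb{Z}$, with $\nu_{\mathfrak{m}}$ and $S_{\mathfrak{m}}$ as in the context. Then $P\mapsto\nu_{\mathfrak{m}}\big((P\,{}^*\mathbb{Z}_{\mathfrak{m}})\setminus\{0\}\big)$ is a one-to-one correspondence between the prime ideals $P$ of ${}^*\mathbb{Z}$ contained in $\mathfrak{m}$ and the proper radical subsemigroups of $S_{\mathfrak{m}}$ without right-end-point.
   Context: It is known (Olberding–Saydam) that the localization ${}^*\mathbb{Z}_{\mathfrak{m}}$ is a valuation domain; let $\nu_{\mathfrak{m}}$ be its valuation, with values in a totally ordered abelian group written multiplicatively, $\nu_{\mathfrak{m}}(a)\le\nu_{\mathfrak{m}}(b)$ iff $b/a\in{}^*\mathbb{Z}_{\mathfrak{m}}$, and $S_{\mathfrak{m}}=\nu_{\mathfrak{m}}({}^*\mathbb{Z}_{\mathfrak{m}}\setminus\{0\})$ as an ordered semigroup. A subsemigroup $T\subseteq S_{\mathfrak{m}}$ (a subset closed under multiplication) is proper if $T\neq S_{\mathfrak{m}}$; convex if $t_1<s<t_2$ with $t_1,t_2\in T$ implies $s\in T$; radical if whenever $x\in T$, $n>0$, $y\in S_{\mathfrak{m}}$, $y^n=x$, then $y\in T$; and without right-end-point if it is convex and $x\in T$, $y\in S_{\mathfrak{m}}$, $x<y$ imply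 $y\in T$. -}

module Defs where

open import Algebra.Bundles using (CommutativeRing; AbelianGroup)
import Algebra.Construct.Pointwise as Pointwise
open import Algebra.Definitions.RawMonoid using () renaming (_×_ to power)
import Algebra.Properties.AbelianGroup as AbelianGroupProperties
import Algebra.Properties.CommutativeSemigroup as CommutativeSemigroupProperties
import Algebra.Properties.Ring as RingProperties
import Algebra.Solver.Ring.NaturalCoefficients.Default as SemiringSolver
open import Data.Integer.Base as ℤ using (ℤ; 0ℤ)
import Data.Integer.Properties as ℤ
open import Data.Nat.Base as ℕ using (ℕ)
open import Data.Product.Base using (Σ; Σ-syntax; ∃; ∃-syntax; _×_; _,_; proj₁; proj₂)
open import Data.Sum.Base using (_⊎_; inj₁; inj₂; [_,_]; [_,_]′)
open import Function.Base using (_∘_)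
open import Function.Bundles using (_⇔_)
open import Level using (0ℓ; suc)
open import Relation.Binary.Bundles using (Setoid)
open import Relation.Binary.Core using (Rel)
open import Relation.Binary.PropositionalEquality.Core as ≡ using (_≡_)
import Relation.Binary.Construct.NonStrictToStrict as Strict
import Relation.Binary.Reasoning.Setoid as SetoidReasoning
open import Relation.Nullary.Negation using (¬_; contradiction)
open import Relation.Unary using (Pred; _∈_; _∉_; _⊆_; _≐_; _∩_; ∅; ∁) renaming (U to All)
open import Relation.Unary.Properties using (≐-refl; ≐-sym; ≐-trans)

-- Subsets are Set-valued predicates.  Rings, ideals and value sets all live at
-- level 0ℓ, where (given excluded middle for Set) this is no restriction.
record Ultrafilter (I : Set) : Set₁ where
  field
    Large   : Pred (Pred I 0ℓ) 0ℓ
    all     : Large All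
    meet    : ∀ {A B} → Large A → Large B → Large (A ∩ B)
    upward  : ∀ {A B} → A ⊆ B → Large A → Large B
    proper  : ¬ Large ∅
    ultra   : ∀ A → Large A ⊎ Large (∁ A)

Principal : ∀ {I} → Ultrafilter I → Set₁
Principal 𝒰 = ∃[ i ] (∀ A → Large A ⇔ i ∈ A)
  where open Ultrafilter 𝒰

module _ {I : Set} (𝒰 : Ultrafilter I) where
  open Ultrafilter 𝒰

  private
    ℤᴵ : CommutativeRing 0ℓ 0ℓ
    ℤᴵ = Pointwise.commutativeRing I ℤ.+-*-commutativeRing

    module ℤᴵ = CommutativeRing ℤᴵ

    everywhere : ∀ {A} → (∀ i → A i) → Large A
    everywhere h = upward (λ {i} _ → h i) all

  Ultrapower : CommutativeRing 0ℓ 0ℓ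
  Ultrapower = record
    { Carrier = I → ℤ
    ; _≈_ = λ f g → Large (λ i → f i ≡ g i)
    ; _+_ = ℤᴵ._+_
    ; _*_ = ℤᴵ._*_
    ; -_  = ℤᴵ.-_
    ; 0#  = ℤᴵ.0#
    ; 1#  = ℤᴵ.1#
    ; isCommutativeRing = record
      { isRing = record
        { +-isAbelianGroup = record
          { isGroup = record
            { isMonoid = record
              { isSemigroup = record
                { isMagma = record
                  { isEquivalence = record
                    { refl  = everywhere (λ _ → ≡.refl)
                    ; sym   = upward ≡.sym
                    ; trans = λ p q → upward (λ (x , y) → ≡.trans x y) (meet p q)
                    }
                  ; ∙-cong = λ p q → upward (λ (x , y) → ≡.cong₂ ℤ._+_ x y) (meet p q)
                  }
                ; assoc = λ f g h → everywhere (ℤᴵ.+-assoc f g h)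
                }
              ; identity = everywhere ∘ ℤᴵ.+-identityˡ , everywhere ∘ ℤᴵ.+-identityʳ
              }
            ; inverse = everywhere ∘ ℤᴵ.-‿inverseˡ , everywhere ∘ ℤᴵ.-‿inverseʳ
            ; ⁻¹-cong = upward (≡.cong (λ z → ℤ.- z))
            }
          ; comm = λ f g → everywhere (ℤᴵ.+-comm f g)
          }
        ; *-cong = λ p q → upward (λ (x , y) → ≡.cong₂ ℤ._*_ x y) (meet p q)
        ; *-assoc = λ f g h → everywhere (ℤᴵ.*-assoc f g h)
        ; *-identity = everywhere ∘ ℤᴵ.*-identityˡ , everywhere ∘ ℤᴵ.*-identityʳ
        ; distrib = (λ f g h → everywhere (ℤᴵ.distribˡ f g h))
                  , (λ f g h → everywhere (ℤᴵ.distribʳ f g h))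
        }
      ; *-comm = λ f g → everywhere (ℤᴵ.*-comm f g)
      }
    }

module _ (R : CommutativeRing 0ℓ 0ℓ) where
  open CommutativeRing R

  record IsIdeal (J : Pred Carrier 0ℓ) : Set where
    field
      resp     : ∀ {x y} → x ≈ y → x ∈ J → y ∈ J
      0∈       : 0# ∈ J
      +-closed : ∀ {x y} → x ∈ J → y ∈ J → x + y ∈ J
      *-closed : ∀ r {x} → x ∈ J → r * x ∈ J

  record IsPrimeIdeal (P : Pred Carrier 0ℓ) : Set where
    field
      isIdeal : IsIdeal P
      1∉      : 1# ∉ P
      prime   : ∀ {x y} → x * y ∈ P → x ∈ P ⊎ y ∈ P
    open IsIdeal isIdeal public

  record IsMaximalIdeal (M : Pred Carrier 0ℓ) : Set₁ where
    field
      isIdeal : IsIdeal M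
      1∉      : 1# ∉ M
      maximal : ∀ {J} → IsIdeal J → 1# ∉ J → M ⊆ J → J ⊆ M
    open IsIdeal isIdeal public

  data GeneratedIdeal (A : Pred Carrier 0ℓ) : Pred Carrier 0ℓ where
    generator : ∀ {x} → x ∈ A → x ∈ GeneratedIdeal A
    respects  : ∀ {x y} → x ≈ y → x ∈ GeneratedIdeal A → y ∈ GeneratedIdeal A
    null      : 0# ∈ GeneratedIdeal A
    sum       : ∀ {x y} → x ∈ GeneratedIdeal A → y ∈ GeneratedIdeal A → x + y ∈ GeneratedIdeal A
    multiple  : ∀ r {x} → x ∈ GeneratedIdeal A → r * x ∈ GeneratedIdeal A

  Unit : Pred Carrier 0ℓ
  Unit u = ∃[ v ] u * v ≈ 1#

  record IsIntegralDomain : Set where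
    field
      1≉0            : ¬ 1# ≈ 0#
      noZeroDivisors : ∀ {x y} → x * y ≈ 0# → x ≈ 0# ⊎ y ≈ 0#

  NonZero : Pred Carrier 0ℓ
  NonZero x = ¬ x ≈ 0#

  record IsMultiplicative (S : Pred Carrier 0ℓ) : Set where
    field
      1∈       : 1# ∈ S
      *-closed : ∀ {x y} → x ∈ S → y ∈ S → x * y ∈ S

  nonZero-isMultiplicative : IsIntegralDomain → IsMultiplicative NonZero
  nonZero-isMultiplicative dom = record
    { 1∈       = 1≉0
    ; *-closed = λ x≉0 y≉0 xy≈0 → [ x≉0 , y≉0 ] (noZeroDivisors xy≈0)
    }
    where open IsIntegralDomain dom

  maximal-complement-isMultiplicative : ∀ {M} → IsMaximalIdeal M → IsMultiplicative (∁ M)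
  maximal-complement-isMultiplicative {M} max = record
    { 1∈ = 1∉
    ; *-closed = λ {s} {t} s∉M t∉M st∈M → s∉M (maximal
        {λ x → ∃[ a ] ∃[ b ] a ∈ M × x ≈ a + b * s}
        (record
          { resp     = λ x≈y (a , b , a∈M , e) → a , b , a∈M , trans (sym x≈y) e
          ; 0∈       = 0# , 0# , 0∈ , lemma₁ s
          ; +-closed = λ (a , b , a∈M , e) (a′ , b′ , a′∈M , e′) →
              a + a′ , b + b′ , +-closed a∈M a′∈M , trans (+-cong e e′) (lemma₂ a b a′ b′ s)
          ; *-closed = λ r (a , b , a∈M , e) →
              r * a , r * b , *-closed r a∈M , trans (*-congˡ e) (lemma₃ r a b s)
          })
        (λ (a , b , a∈M , e) → t∉M (resp
          (trans (sym (lemma₄ a b s t)) (trans (*-congˡ (sym e)) (*-identityʳ t)))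
          (+-closed (*-closed t a∈M) (*-closed b st∈M))))
        (λ {a} a∈M → a , 0# , a∈M , lemma₅ a s)
        (0# , 1# , 0∈ , lemma₆ s))
    }
    where
    open IsMaximalIdeal max
    open SemiringSolver commutativeSemiring
    lemma₁ : ∀ s → 0# ≈ 0# + 0# * s
    lemma₁ = solve 1 (λ s → con 0 := con 0 :+ con 0 :* s) refl
    lemma₂ : ∀ a b a′ b′ s → (a + b * s) + (a′ + b′ * s) ≈ (a + a′) + (b + b′) * s
    lemma₂ = solve 5 (λ a b a′ b′ s →
      (a :+ b :* s) :+ (a′ :+ b′ :* s)
      := (a :+ a′) :+ (b :+ b′) :* s) refl
    lemma₃ : ∀ r a b s → r * (a + b * s) ≈ r * a + r * b * s
    lemma₃ = solve 4 (λ r a b s → r :* (a :+ b :* s) := r :* a :+ r :* b :* s) refl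
    lemma₄ : ∀ a b s t → t * (a + b * s) ≈ t * a + b * (s * t)
    lemma₄ = solve 4 (λ a b s t → t :* (a :+ b :* s) := t :* a :+ b :* (s :* t)) refl
    lemma₅ : ∀ a s → a ≈ a + 0# * s
    lemma₅ = solve 2 (λ a s → a := a :+ con 0 :* s) refl
    lemma₆ : ∀ s → s ≈ 0# + 1# * s
    lemma₆ = solve 1 (λ s → s := con 0 :+ con 1 :* s) refl

module Localize (R : CommutativeRing 0ℓ 0ℓ)
                {S : Pred (CommutativeRing.Carrier R) 0ℓ} (mult : IsMultiplicative R S) where
  open CommutativeRing R
  open IsMultiplicative mult
  open RingProperties ring using (-‿distribˡ-*; -‿distribʳ-*)

  record Fraction : Set where
    constructor _/_[_]
    field
      num   : Carrier
      den   : Carrier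
      den∈S : den ∈ S

  open Fraction public

  infix 4 _~_

  record _~_ (x y : Fraction) : Set where
    constructor by
    field
      factor   : Carrier
      factor∈S : factor ∈ S
      equation : factor * (num x * den y) ≈ factor * (num y * den x)

  ι : Carrier → Fraction
  ι a = a / 1# [ 1∈ ]

  exact : ∀ {x y} → num x * den y ≈ num y * den x → x ~ y
  exact e = by 1# 1∈ (*-congˡ e)

  private
    open SemiringSolver commutativeSemiring

    infixl 6 _⊕_
    infixl 7 _⊗_
    infix  8 ⊖_

    _⊕_ _⊗_ : Fraction → Fraction → Fraction
    (a / s [ s∈ ]) ⊕ (b / t [ t∈ ]) = (a * t + b * s) / s * t [ *-closed s∈ t∈ ]
    (a / s [ s∈ ]) ⊗ (b / t [ t∈ ]) = (a * b) / s * t [ *-closed s∈ t∈ ]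

    ⊖_ : Fraction → Fraction
    ⊖ (a / s [ s∈ ]) = (- a) / s [ s∈ ]

    ~-trans : ∀ {x y z} → x ~ y → y ~ z → x ~ z
    ~-trans {a / s [ _ ]} {b / t [ t∈ ]} {c / r [ _ ]} (by u u∈ p) (by v v∈ q) =
      by (u * v * t) (*-closed (*-closed u∈ v∈) t∈) (begin
        u * v * t * (a * r)    ≈⟨ l₁ u v t a r ⟩
        v * r * (u * (a * t))  ≈⟨ *-congˡ p ⟩
        v * r * (u * (b * s))  ≈⟨ l₂ u v r b s ⟩
        u * s * (v * (b * r))  ≈⟨ *-congˡ q ⟩
        u * s * (v * (c * t))  ≈⟨ l₃ u v t c s ⟩
        u * v * t * (c * s)    ∎)
      where
      open SetoidReasoning setoid
      l₁ : ∀ u v t a r → u * v * t * (a * r) ≈ v * r * (u * (a * t))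
      l₁ = solve 5 (λ u v t a r → u :* v :* t :* (a :* r) := v :* r :* (u :* (a :* t))) refl
      l₂ : ∀ u v r b s → v * r * (u * (b * s)) ≈ u * s * (v * (b * r))
      l₂ = solve 5 (λ u v r b s → v :* r :* (u :* (b :* s)) := u :* s :* (v :* (b :* r))) refl
      l₃ : ∀ u v t c s → u * s * (v * (c * t)) ≈ u * v * t * (c * s)
      l₃ = solve 5 (λ u v t c s → u :* s :* (v :* (c :* t)) := u :* v :* t :* (c :* s)) refl

    ⊕-cong : ∀ {x x′ y y′} → x ~ x′ → y ~ y′ → x ⊕ y ~ x′ ⊕ y′
    ⊕-cong {a / s [ _ ]} {a′ / s′ [ _ ]} {b / t [ _ ]} {b′ / t′ [ _ ]} (by u u∈ p) (by v v∈ q) =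
      by (u * v) (*-closed u∈ v∈) (begin
        u * v * ((a * t + b * s) * (s′ * t′))
          ≈⟨ l₁ u v a b s t s′ t′ ⟩
        v * t * t′ * (u * (a * s′)) + u * s * s′ * (v * (b * t′))
          ≈⟨ +-cong (*-congˡ p) (*-congˡ q) ⟩
        v * t * t′ * (u * (a′ * s)) + u * s * s′ * (v * (b′ * t))
          ≈⟨ l₂ u v a′ b′ s t s′ t′ ⟩
        u * v * ((a′ * t′ + b′ * s′) * (s * t)) ∎)
      where
      open SetoidReasoning setoid
      l₁ : ∀ u v a b s t s′ t′ → u * v * ((a * t + b * s) * (s′ * t′))
           ≈ v * t * t′ * (u * (a * s′)) + u * s * s′ * (v * (b * t′))
      l₁ = solve 8 (λ u v a b s t s′ t′ →
        u :* v :* ((a :* t :+ b :* s) :* (s′ :* t′))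
        := v :* t :* t′ :* (u :* (a :* s′)) :+ u :* s :* s′ :* (v :* (b :* t′))) refl
      l₂ : ∀ u v a′ b′ s t s′ t′ → v * t * t′ * (u * (a′ * s)) + u * s * s′ * (v * (b′ * t))
           ≈ u * v * ((a′ * t′ + b′ * s′) * (s * t))
      l₂ = solve 8 (λ u v a′ b′ s t s′ t′ →
        v :* t :* t′ :* (u :* (a′ :* s)) :+ u :* s :* s′ :* (v :* (b′ :* t))
        := u :* v :* ((a′ :* t′ :+ b′ :* s′) :* (s :* t))) refl

    ⊗-cong : ∀ {x x′ y y′} → x ~ x′ → y ~ y′ → x ⊗ y ~ x′ ⊗ y′
    ⊗-cong {a / s [ _ ]} {a′ / s′ [ _ ]} {b / t [ _ ]} {b′ / t′ [ _ ]} (by u u∈ p) (by v v∈ q) =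
      by (u * v) (*-closed u∈ v∈) (begin
        u * v * (a * b * (s′ * t′))      ≈⟨ l u v a b s′ t′ ⟩
        u * (a * s′) * (v * (b * t′))    ≈⟨ *-cong p q ⟩
        u * (a′ * s) * (v * (b′ * t))    ≈⟨ l u v a′ b′ s t ⟨
        u * v * (a′ * b′ * (s * t))      ∎)
      where
      open SetoidReasoning setoid
      l : ∀ u v a b s t → u * v * (a * b * (s * t)) ≈ u * (a * s) * (v * (b * t))
      l = solve 6 (λ u v a b s t →
        u :* v :* (a :* b :* (s :* t))
        := u :* (a :* s) :* (v :* (b :* t))) refl

    ⊖-cong : ∀ {x y} → x ~ y → ⊖ x ~ ⊖ y
    ⊖-cong {a / s [ _ ]} {b / t [ _ ]} (by u u∈ p) =
      by u u∈ (trans (l u a t) (trans (-‿cong p) (sym (l u b s))))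
      where
      l : ∀ u a t → u * (- a * t) ≈ - (u * (a * t))
      l u a t = trans (*-congˡ (sym (-‿distribˡ-* a t))) (sym (-‿distribʳ-* u (a * t)))

    +assoc : ∀ a s b t c r → ((a * t + b * s) * r + c * (s * t)) * (s * (t * r))
             ≈ (a * (t * r) + (b * r + c * t) * s) * (s * t * r)
    +assoc = solve 6 (λ a s b t c r →
      ((a :* t :+ b :* s) :* r :+ c :* (s :* t)) :* (s :* (t :* r))
      := (a :* (t :* r) :+ (b :* r :+ c :* t) :* s) :* (s :* t :* r)) refl
    +comm : ∀ a s b t → (a * t + b * s) * (t * s) ≈ (b * s + a * t) * (s * t)
    +comm = solve 4 (λ a s b t → (a :* t :+ b :* s) :* (t :* s) := (b :* s :+ a :* t) :* (s :* t)) refl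
    +idˡ : ∀ a s → (0# * s + a * 1#) * s ≈ a * (1# * s)
    +idˡ = solve 2 (λ a s → (con 0 :* s :+ a :* con 1) :* s := a :* (con 1 :* s)) refl
    +idʳ : ∀ a s → (a * 1# + 0# * s) * s ≈ a * (s * 1#)
    +idʳ = solve 2 (λ a s → (a :* con 1 :+ con 0 :* s) :* s := a :* (s :* con 1)) refl
    +invˡ : ∀ a s → (- a * s + a * s) * 1# ≈ 0# * (s * s)
    +invˡ a s = trans (*-identityʳ _) (begin
      - a * s + a * s  ≈⟨ distribʳ s (- a) a ⟨
      (- a + a) * s    ≈⟨ *-congʳ (-‿inverseˡ a) ⟩
      0# * s           ≈⟨ zeroˡ s ⟩
      0#               ≈⟨ zeroˡ (s * s) ⟨
      0# * (s * s)     ∎)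
      where open SetoidReasoning setoid
    +invʳ : ∀ a s → (a * s + - a * s) * 1# ≈ 0# * (s * s)
    +invʳ a s = trans (*-congʳ (+-comm (a * s) (- a * s))) (+invˡ a s)
    *assoc : ∀ a s b t c r → a * b * c * (s * (t * r)) ≈ a * (b * c) * (s * t * r)
    *assoc = solve 6 (λ a s b t c r →
      a :* b :* c :* (s :* (t :* r))
      := a :* (b :* c) :* (s :* t :* r)) refl
    *comm′ : ∀ a s b t → a * b * (t * s) ≈ b * a * (s * t)
    *comm′ = solve 4 (λ a s b t → a :* b :* (t :* s) := b :* a :* (s :* t)) refl
    *idˡ : ∀ a s → 1# * a * s ≈ a * (1# * s)
    *idˡ = solve 2 (λ a s → con 1 :* a :* s := a :* (con 1 :* s)) refl
    *idʳ : ∀ a s → a * 1# * s ≈ a * (s * 1#)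
    *idʳ = solve 2 (λ a s → a :* con 1 :* s := a :* (s :* con 1)) refl
    distˡ : ∀ a s b t c r → a * (b * r + c * t) * (s * t * (s * r))
            ≈ (a * b * (s * r) + a * c * (s * t)) * (s * (t * r))
    distˡ = solve 6 (λ a s b t c r →
      a :* (b :* r :+ c :* t) :* (s :* t :* (s :* r))
      := (a :* b :* (s :* r) :+ a :* c :* (s :* t)) :* (s :* (t :* r))) refl
    distʳ : ∀ a s b t c r → (b * r + c * t) * a * (t * s * (r * s))
            ≈ (b * a * (r * s) + c * a * (t * s)) * (t * r * s)
    distʳ = solve 6 (λ a s b t c r →
      (b :* r :+ c :* t) :* a :* (t :* s :* (r :* s))
      := (b :* a :* (r :* s) :+ c :* a :* (t :* s)) :* (t :* r :* s)) refl

  Localization : CommutativeRing 0ℓ 0ℓ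
  Localization = record
    { Carrier = Fraction
    ; _≈_ = _~_
    ; _+_ = _⊕_
    ; _*_ = _⊗_
    ; -_  = ⊖_
    ; 0#  = ι 0#
    ; 1#  = ι 1#
    ; isCommutativeRing = record
      { isRing = record
        { +-isAbelianGroup = record
          { isGroup = record
            { isMonoid = record
              { isSemigroup = record
                { isMagma = record
                  { isEquivalence = record
                    { refl  = exact refl
                    ; sym   = λ (by u u∈ p) → by u u∈ (sym p)
                    ; trans = ~-trans
                    }
                  ; ∙-cong = ⊕-cong
                  }
                ; assoc = λ (a / s [ _ ]) (b / t [ _ ]) (c / r [ _ ]) → exact (+assoc a s b t c r)
                }
              ; identity = (λ (a / s [ _ ]) → exact (+idˡ a s)) , (λ (a / s [ _ ]) → exact (+idʳ a s))
              }
            ; inverse = (λ (a / s [ _ ]) → exact (+invˡ a s)) , (λ (a / s [ _ ]) → exact (+invʳ a s))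
            ; ⁻¹-cong = ⊖-cong
            }
          ; comm = λ (a / s [ _ ]) (b / t [ _ ]) → exact (+comm a s b t)
          }
        ; *-cong = ⊗-cong
        ; *-assoc = λ (a / s [ _ ]) (b / t [ _ ]) (c / r [ _ ]) → exact (*assoc a s b t c r)
        ; *-identity = (λ (a / s [ _ ]) → exact (*idˡ a s)) , (λ (a / s [ _ ]) → exact (*idʳ a s))
        ; distrib = (λ (a / s [ _ ]) (b / t [ _ ]) (c / r [ _ ]) → exact (distˡ a s b t c r))
                  , (λ (a / s [ _ ]) (b / t [ _ ]) (c / r [ _ ]) → exact (distʳ a s b t c r))
        }
      ; *-comm = λ (a / s [ _ ]) (b / t [ _ ]) → exact (*comm′ a s b t)
      }
    }

  -- The ideal generated by the image of J.
  extension : Pred Carrier 0ℓ → Pred Fraction 0ℓ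
  extension J = GeneratedIdeal Localization (λ x → ∃[ a ] a ∈ J × x ~ ι a)

  module _ (dom : IsIntegralDomain R) (S⊆NonZero : S ⊆ NonZero R) where
    open IsIntegralDomain dom

    ~0⇒num≈0 : ∀ {x} → x ~ ι 0# → num x ≈ 0#
    ~0⇒num≈0 {a / s [ _ ]} (by u u∈ p) =
      [ (λ u≈0 → contradiction u≈0 (S⊆NonZero u∈)) , trans (sym (*-identityʳ a)) ]
      (noZeroDivisors (trans p (trans (*-congˡ (zeroˡ s)) (zeroʳ u))))

    num≈0⇒~0 : ∀ {x} → num x ≈ 0# → x ~ ι 0#
    num≈0⇒~0 {a / s [ _ ]} p = exact (trans (*-identityʳ a) (trans p (sym (zeroˡ s))))

    isIntegralDomain : IsIntegralDomain Localization
    isIntegralDomain = record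
      { 1≉0 = 1≉0 ∘ ~0⇒num≈0
      ; noZeroDivisors =
          [ inj₁ ∘ num≈0⇒~0 , inj₂ ∘ num≈0⇒~0 ] ∘ noZeroDivisors ∘ ~0⇒num≈0
      }

record IsSubgroup (G : AbelianGroup 0ℓ 0ℓ) (H : Pred (AbelianGroup.Carrier G) 0ℓ) : Set where
  open AbelianGroup G
  field
    resp      : ∀ {x y} → x ≈ y → x ∈ H → y ∈ H
    ε∈        : ε ∈ H
    ∙-closed  : ∀ {x y} → x ∈ H → y ∈ H → x ∙ y ∈ H
    ⁻¹-closed : ∀ {x} → x ∈ H → x ⁻¹ ∈ H

module _ (G : AbelianGroup 0ℓ 0ℓ) {H : Pred (AbelianGroup.Carrier G) 0ℓ} (sub : IsSubgroup G H) where
  open AbelianGroup G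
  open AbelianGroupProperties G
  open CommutativeSemigroupProperties commutativeSemigroup using (interchange)
  open IsSubgroup sub
  open SetoidReasoning setoid

  private
    inject : ∀ {x y} → x ≈ y → y ∙ x ⁻¹ ∈ H
    inject {x} {y} x≈y = resp (sym (trans (∙-congʳ (sym x≈y)) (inverseʳ x))) ε∈

    flip-∈ : ∀ x y → (y ∙ x ⁻¹) ⁻¹ ≈ x ∙ y ⁻¹
    flip-∈ x y = begin
      (y ∙ x ⁻¹) ⁻¹     ≈⟨ ⁻¹-anti-homo-∙ y (x ⁻¹) ⟩
      x ⁻¹ ⁻¹ ∙ y ⁻¹    ≈⟨ ∙-congʳ (⁻¹-involutive x) ⟩
      x ∙ y ⁻¹          ∎

    cancel : ∀ x y z → (z ∙ y ⁻¹) ∙ (y ∙ x ⁻¹) ≈ z ∙ x ⁻¹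
    cancel x y z = begin
      (z ∙ y ⁻¹) ∙ (y ∙ x ⁻¹)  ≈⟨ assoc z (y ⁻¹) (y ∙ x ⁻¹) ⟩
      z ∙ (y ⁻¹ ∙ (y ∙ x ⁻¹))  ≈⟨ ∙-congˡ (assoc (y ⁻¹) y (x ⁻¹)) ⟨
      z ∙ (y ⁻¹ ∙ y ∙ x ⁻¹)    ≈⟨ ∙-congˡ (∙-congʳ (inverseˡ y)) ⟩
      z ∙ (ε ∙ x ⁻¹)           ≈⟨ ∙-congˡ (identityˡ (x ⁻¹)) ⟩
      z ∙ x ⁻¹                 ∎

    merge : ∀ x y x′ y′ → (y ∙ x ⁻¹) ∙ (y′ ∙ x′ ⁻¹) ≈ (y ∙ y′) ∙ (x ∙ x′) ⁻¹
    merge x y x′ y′ = begin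
      (y ∙ x ⁻¹) ∙ (y′ ∙ x′ ⁻¹)  ≈⟨ interchange y (x ⁻¹) y′ (x′ ⁻¹) ⟩
      (y ∙ y′) ∙ (x ⁻¹ ∙ x′ ⁻¹)  ≈⟨ ∙-congˡ (⁻¹-∙-comm x x′) ⟩
      (y ∙ y′) ∙ (x ∙ x′) ⁻¹     ∎

  QuotientGroup : AbelianGroup 0ℓ 0ℓ
  QuotientGroup = record
    { Carrier = Carrier
    ; _≈_ = λ x y → y ∙ x ⁻¹ ∈ H
    ; _∙_ = _∙_
    ; ε   = ε
    ; _⁻¹ = _⁻¹
    ; isAbelianGroup = record
      { isGroup = record
        { isMonoid = record
          { isSemigroup = record
            { isMagma = record
              { isEquivalence = record
                { refl  = inject refl
                ; sym   = λ {x} {y} p → resp (flip-∈ x y) (⁻¹-closed p)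
                ; trans = λ {x} {y} {z} p q → resp (cancel x y z) (∙-closed q p)
                }
              ; ∙-cong = λ {x} {y} {x′} {y′} p q → resp (merge x y x′ y′) (∙-closed p q)
              }
            ; assoc = λ x y z → inject (assoc x y z)
            }
          ; identity = (λ x → inject (identityˡ x)) , (λ x → inject (identityʳ x))
          }
        ; inverse = (λ x → inject (inverseˡ x)) , (λ x → inject (inverseʳ x))
        ; ⁻¹-cong = λ {x} {y} p → resp (sym (⁻¹-∙-comm y (x ⁻¹))) (⁻¹-closed p)
        }
      ; comm = λ x y → inject (comm x y)
      }
    }

-- The canonical valuation of D: the quotient map from K^×, for K the field of
-- fractions of D, to K^× / D^×, ordered by ν a ≤ ν b iff b / a ∈ D.  The
-- construction makes sense for any domain; ≤ is total on K^× / D^× exactly when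
-- D is a valuation domain.
module Valuation (D : CommutativeRing 0ℓ 0ℓ) (dom : IsIntegralDomain D) where
  private
    module D = CommutativeRing D

  module Frac = Localize D (nonZero-isMultiplicative D dom)
  open Frac using (_/_[_]; num; ι)

  FractionField : CommutativeRing 0ℓ 0ℓ
  FractionField = Frac.Localization

  private
    module K = CommutativeRing FractionField

    K^×-nonZero : IsMultiplicative FractionField (NonZero FractionField)
    K^×-nonZero = nonZero-isMultiplicative FractionField (Frac.isIntegralDomain dom (λ x → x))

    num≉0 : ∀ {x} → NonZero FractionField x → NonZero D (num x)
    num≉0 x≉0 = x≉0 ∘ Frac.num≈0⇒~0 dom (λ z → z)

    ≉0 : ∀ {x} → NonZero D (num x) → NonZero FractionField x
    ≉0 x≉0 = x≉0 ∘ Frac.~0⇒num≈0 dom (λ z → z)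

    inv : ∃ (NonZero FractionField) → ∃ (NonZero FractionField)
    inv ((a / s [ s≉0 ]) , x≉0) = (s / a [ num≉0 x≉0 ]) , ≉0 s≉0

    inv-cong : ∀ {x y} → proj₁ x K.≈ proj₁ y → proj₁ (inv x) K.≈ proj₁ (inv y)
    inv-cong {(a / s [ _ ]) , _} {(b / t [ _ ]) , _} (Frac.by u u≉0 p) = Frac.by u u≉0
      (D.trans (D.*-congˡ (D.*-comm s b)) (D.trans (D.sym p) (D.*-congˡ (D.*-comm a t))))

    inv-inverseˡ : ∀ x → proj₁ (inv x) K.* proj₁ x K.≈ K.1#
    inv-inverseˡ ((a / s [ _ ]) , _) =
      Frac.exact (D.trans (D.*-identityʳ _) (D.trans (D.*-comm s a) (D.sym (D.*-identityˡ _))))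

  K^× : AbelianGroup 0ℓ 0ℓ
  K^× = record
    { Carrier = ∃ (NonZero FractionField)
    ; _≈_ = λ x y → proj₁ x K.≈ proj₁ y
    ; _∙_ = λ (x , x≉0) (y , y≉0) → x K.* y , *-closed x≉0 y≉0
    ; ε   = K.1# , 1∈
    ; _⁻¹ = inv
    ; isAbelianGroup = record
      { isGroup = record
        { isMonoid = record
          { isSemigroup = record
            { isMagma = record
              { isEquivalence = record { refl = K.refl ; sym = K.sym ; trans = K.trans }
              ; ∙-cong = K.*-cong
              }
            ; assoc = λ (x , _) (y , _) (z , _) → K.*-assoc x y z
            }
          ; identity = (λ (x , _) → K.*-identityˡ x) , (λ (x , _) → K.*-identityʳ x)
          }
        ; inverse = inv-inverseˡ
                  , (λ x → K.trans (K.*-comm (proj₁ x) (proj₁ (inv x))) (inv-inverseˡ x))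
        ; ⁻¹-cong = λ {x} {y} → inv-cong {x} {y}
        }
      ; comm = λ (x , _) (y , _) → K.*-comm x y
      }
    }
    where open IsMultiplicative K^×-nonZero

  private
    module K^× = AbelianGroup K^×

    ι-* : ∀ a b → ι a K.* ι b K.≈ ι (a D.* b)
    ι-* a b = Frac.exact (D.*-congˡ (D.sym (D.*-identityʳ D.1#)))

    ι-cong : ∀ {a b} → a D.≈ b → ι a K.≈ ι b
    ι-cong a≈b = Frac.exact (D.*-congʳ a≈b)

  -- The units of D, as a subset of K^×.
  D^× : Pred K^×.Carrier 0ℓ
  D^× (x , _) = ∃[ u ] u ∈ Unit D × x K.≈ ι u

  D^×-isSubgroup : IsSubgroup K^× D^×
  D^×-isSubgroup = record
    { resp      = λ x≈y (u , unit , e) → u , unit , K.trans (K.sym x≈y) e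
    ; ε∈        = D.1# , (D.1# , D.*-identityʳ D.1#) , K.refl
    ; ∙-closed  = λ (u , (u′ , p) , e) (v , (v′ , q) , f) →
        u D.* v
        , (u′ D.* v′ , D.trans (interchange u v u′ v′) (D.trans (D.*-cong p q) (D.*-identityʳ D.1#)))
        , K.trans (K.*-cong e f) (ι-* u v)
    ; ⁻¹-closed = λ {x} (u , (u′ , p) , e) →
        u′ , (u , D.trans (D.*-comm u′ u) p) , (begin
          x⁻¹ x                            ≈⟨ K.*-identityʳ (x⁻¹ x) ⟨
          x⁻¹ x K.* K.1#                   ≈⟨ K.*-congˡ {x⁻¹ x} (ι-cong p) ⟨
          x⁻¹ x K.* ι (u D.* u′)           ≈⟨ K.*-congˡ {x⁻¹ x} (ι-* u u′) ⟨
          x⁻¹ x K.* (ι u K.* ι u′)         ≈⟨ K.*-assoc (x⁻¹ x) (ι u) (ι u′) ⟨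
          x⁻¹ x K.* ι u K.* ι u′           ≈⟨ K.*-congʳ {ι u′} (K.*-congˡ {x⁻¹ x} e) ⟨
          x⁻¹ x K.* proj₁ x K.* ι u′       ≈⟨ K.*-congʳ {ι u′} (K^×.inverseˡ x) ⟩
          K.1# K.* ι u′                    ≈⟨ K.*-identityˡ (ι u′) ⟩
          ι u′                             ∎)
    }
    where
    open SetoidReasoning K.setoid
    open CommutativeSemigroupProperties D.*-commutativeSemigroup using (interchange)
    x⁻¹ : K^×.Carrier → K.Carrier
    x⁻¹ x = proj₁ (x K^×.⁻¹)

  ι-nonZero : ∀ {a} → NonZero D a → NonZero FractionField (ι a)
  ι-nonZero = ≉0

  Γ : AbelianGroup 0ℓ 0ℓ
  Γ = QuotientGroup K^× D^×-isSubgroup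

  private module Γ = AbelianGroup Γ

  ν : (x : K.Carrier) → NonZero FractionField x → Γ.Carrier
  ν x x≉0 = x , x≉0

  infix 4 _≤_

  _≤_ : Rel Γ.Carrier 0ℓ
  a ≤ b = ∃[ r ] proj₁ (b K^×.∙ a K^×.⁻¹) K.≈ ι r

  -- ν (A ∖ {0})
  image : Pred D.Carrier 0ℓ → Pred Γ.Carrier 0ℓ
  image A γ = ∃[ a ] Σ[ a≉0 ∈ NonZero D a ] a ∈ A × ν (ι a) (ι-nonZero a≉0) Γ.≈ γ

  S : Pred Γ.Carrier 0ℓ
  S = image All

module Subsemigroups (Γ : AbelianGroup 0ℓ 0ℓ)
                     (_≤_ : Rel (AbelianGroup.Carrier Γ) 0ℓ)
                     (S : Pred (AbelianGroup.Carrier Γ) 0ℓ) where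
  open AbelianGroup Γ
  open Strict _≈_ _≤_ using (_<_)

  infixr 8 _^_

  _^_ : Carrier → ℕ → Carrier
  x ^ n = power rawMonoid n x

  -- The empty subsemigroup is allowed: it corresponds to the zero ideal.
  record IsSubsemigroup (T : Pred Carrier 0ℓ) : Set where
    field
      resp     : ∀ {x y} → x ≈ y → x ∈ T → y ∈ T
      T⊆S      : T ⊆ S
      ∙-closed : ∀ {x y} → x ∈ T → y ∈ T → x ∙ y ∈ T

  Proper : Pred (Pred Carrier 0ℓ) 0ℓ
  Proper T = ¬ (T ≐ S)

  Convex : Pred (Pred Carrier 0ℓ) 0ℓ
  Convex T = ∀ {t₁ t₂ s} → t₁ ∈ T → t₂ ∈ T → s ∈ S → t₁ < s → s < t₂ → s ∈ T

  Radical : Pred (Pred Carrier 0ℓ) 0ℓ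
  Radical T = ∀ {x y} n → x ∈ T → n ℕ.> 0 → y ∈ S → y ^ n ≈ x → y ∈ T

  WithoutRightEndPoint : Pred (Pred Carrier 0ℓ) 0ℓ
  WithoutRightEndPoint T = Convex T × (∀ {x y} → x ∈ T → y ∈ S → x < y → y ∈ T)

  record IsProperRadicalWithoutRightEndPoint (T : Pred Carrier 0ℓ) : Set where
    field
      isSubsemigroup       : IsSubsemigroup T
      proper               : Proper T
      radical              : Radical T
      withoutRightEndPoint : WithoutRightEndPoint T

subsetSetoid : ∀ {A : Set} → Pred (Pred A 0ℓ) 0ℓ → Setoid (suc 0ℓ) 0ℓ
subsetSetoid {A} 𝒫 = record
  { Carrier = ∃ 𝒫
  ; _≈_ = λ X Y → proj₁ X ≐ proj₁ Y
  ; isEquivalence = record { refl = ≐-refl ; sym = ≐-sym ; trans = ≐-trans }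
  }

Ultrapower-isIntegralDomain : ∀ {I} (𝒰 : Ultrafilter I) → IsIntegralDomain (Ultrapower 𝒰)
Ultrapower-isIntegralDomain 𝒰 = record
  { 1≉0 = λ p → proper (upward (λ ()) p)
  ; noZeroDivisors = λ {f} {g} p → [ inj₁ , (λ q → inj₂ (upward (resolve f g) (meet p q))) ]′
      (ultra (λ i → f i ≡ 0ℤ))
  }
  where
  open Ultrafilter 𝒰
  resolve : ∀ f g {i} → f i ℤ.* g i ≡ 0ℤ × ¬ f i ≡ 0ℤ → g i ≡ 0ℤ
  resolve f g {i} (p , f≢0) = [ (λ f≡0 → contradiction f≡0 f≢0) , (λ g≡0 → g≡0) ]
    (ℤ.i*j≡0⇒i≡0∨j≡0 (f i) p)

module AtMaximalIdeal
  {I : Set} (𝒰 : Ultrafilter I)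
  {𝔪 : Pred (CommutativeRing.Carrier (Ultrapower 𝒰)) 0ℓ}
  (𝔪-max : IsMaximalIdeal (Ultrapower 𝒰) 𝔪)
  where

  *ℤ : CommutativeRing 0ℓ 0ℓ
  *ℤ = Ultrapower 𝒰

  open CommutativeRing *ℤ using (Carrier; sym)

  open IsMaximalIdeal 𝔪-max using (resp; 0∈)

  module L = Localize *ℤ (maximal-complement-isMultiplicative *ℤ 𝔪-max)

  *ℤ-𝔪 : CommutativeRing 0ℓ 0ℓ
  *ℤ-𝔪 = L.Localization

  *ℤ-𝔪-isIntegralDomain : IsIntegralDomain *ℤ-𝔪
  *ℤ-𝔪-isIntegralDomain = L.isIntegralDomain (Ultrapower-isIntegralDomain 𝒰)
    (λ {s} s∉𝔪 s≈0 → s∉𝔪 (resp (sym {s} s≈0) 0∈))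

  open Valuation *ℤ-𝔪 *ℤ-𝔪-isIntegralDomain using (Γ; _≤_; S; image)
  open Subsemigroups Γ _≤_ S using (IsProperRadicalWithoutRightEndPoint)

  PrimesBelow𝔪 : Setoid (suc 0ℓ) 0ℓ
  PrimesBelow𝔪 = subsetSetoid (λ P → IsPrimeIdeal *ℤ P × P ⊆ 𝔪)

  ProperRadicalSubsemigroupsWithoutRightEndPoint : Setoid (suc 0ℓ) 0ℓ
  ProperRadicalSubsemigroupsWithoutRightEndPoint = subsetSetoid IsProperRadicalWithoutRightEndPoint

  -- ν_𝔪 (P *ℤ_𝔪 ∖ {0}), where L.extension P is the ideal P *ℤ_𝔪.
  valuesOf : Pred Carrier 0ℓ → Pred (AbelianGroup.Carrier Γ) 0ℓ
  valuesOf P = image (L.extension P)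

{-# OPTIONS --safe #-}

-- By Bézout in ℤ, any f, g ∈ *ℤ satisfy a g = b f with (a, b) = 1, and a or b lies outside 𝔪,
-- so *ℤ_𝔪 is a valuation domain.  The correspondence is the composite of P ↦ P *ℤ_𝔪 with
-- Q ↦ ν_𝔪 (Q ∖ {0}).  The second map is inverted by T ↦ {a ∣ a = 0 or ν_𝔪 a ∈ T}, an ideal since
-- T is upward closed, and prime since a ∣ b gives ν_𝔪 (a b) ≤ (ν_𝔪 b)², whence ν_𝔪 b ∈ T by radicality.
module Submission where

open import Defs
open import Algebra.Bundles using (CommutativeRing; AbelianGroup)
open import Algebra.Definitions.RawMonoid using () renaming (_×_ to power)
import Algebra.Properties.Ring as RingProperties
import Algebra.Solver.Ring.NaturalCoefficients.Default as SemiringSolver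
open import Axiom.ExcludedMiddle using (ExcludedMiddle)
open import Data.Integer.Base as ℤ using (ℤ; +_; 0ℤ; 1ℤ)
import Data.Integer.Divisibility.Signed as ℤ∣
import Data.Integer.Properties as ℤ
open import Data.Integer.Tactic.RingSolver using (solve-∀)
open import Data.Nat.Base as ℕ using (ℕ; s≤s; z≤n)
import Data.Nat.Divisibility as ℕ∣
open import Data.Nat.GCD using (module GCD; module Bézout)
open import Data.Product.Base using (Σ-syntax; ∃-syntax; _×_; _,_; proj₁; proj₂)
open import Data.Sum.Base as Sum using (_⊎_; inj₁; inj₂; [_,_]; [_,_]′)
import Function.Construct.Composition as Composition
open import Function.Base using (_∘_)
open import Function.Bundles using (_⤖_; Bijection)
open import Level using (0ℓ)
open import Relation.Binary.Bundles using (Setoid)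
open import Relation.Binary.PropositionalEquality as ≡ using (_≡_)
import Relation.Binary.Reasoning.Setoid as SetoidReasoning
open import Relation.Nullary.Decidable using (Dec; yes; no; decidable-stable)
open import Relation.Nullary.Negation using (¬_; contradiction)
open import Relation.Unary using (Pred; _∈_; _∉_; _⊆_; _≐_; ∁)
open import Relation.Unary.Properties using (≐-refl; ≐-trans)

-- Generalities on domains and prime ideals

PrimeIdeals : CommutativeRing 0ℓ 0ℓ → Setoid _ _
PrimeIdeals R = subsetSetoid (IsPrimeIdeal R)

-- For an integral domain this is the valuation-domain property.
DivisibilityTotal : CommutativeRing 0ℓ 0ℓ → Set
DivisibilityTotal R = ∀ a b → (∃[ r ] b ≈ r * a) ⊎ (∃[ r ] a ≈ r * b)
  where open CommutativeRing R

module _ (R : CommutativeRing 0ℓ 0ℓ) (dom : IsIntegralDomain R) where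
  open CommutativeRing R
  open IsIntegralDomain dom
  open RingProperties ring using (-‿distribʳ-*; x∙y⁻¹≈ε⇒x≈y; x≈y⇒x∙y⁻¹≈ε)

  *-cancelˡ-nonZero : ∀ {c x y} → c ∈ NonZero R → c * x ≈ c * y → x ≈ y
  *-cancelˡ-nonZero {c} {x} {y} c≉0 cx≈cy =
    [ (λ c≈0 → contradiction c≈0 c≉0) , x∙y⁻¹≈ε⇒x≈y x y ] (noZeroDivisors (begin
      c * (x - y)          ≈⟨ distribˡ c x (- y) ⟩
      c * x + c * - y      ≈⟨ +-congˡ (-‿distribʳ-* c y) ⟨
      c * x - c * y        ≈⟨ x≈y⇒x∙y⁻¹≈ε cx≈cy ⟩
      0#                   ∎))
    where open SetoidReasoning setoid

module _ {R : CommutativeRing 0ℓ 0ℓ} {P : Pred (CommutativeRing.Carrier R) 0ℓ}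
         (isPrime : IsPrimeIdeal R P) where
  open CommutativeRing R
  open IsPrimeIdeal isPrime

  power∈⇒∈ : ∀ {x} n → power *-rawMonoid n x ∈ P → x ∈ P
  power∈⇒∈ ℕ.zero    1∈P = contradiction 1∈P 1∉
  power∈⇒∈ (ℕ.suc n) x∈P = [ (λ x∈P → x∈P) , power∈⇒∈ n ] (prime x∈P)

-- Primes of a localization

module LocalizeAt
  (R : CommutativeRing 0ℓ 0ℓ) {𝔪 : Pred (CommutativeRing.Carrier R) 0ℓ}
  (mult : IsMultiplicative R (∁ 𝔪)) (𝔪-stable : ∁ (∁ 𝔪) ⊆ 𝔪) where
  open CommutativeRing R
  open Localize R mult
  open SemiringSolver commutativeSemiring
  private module R𝔪 = CommutativeRing Localization

  PrimesBelow : Setoid _ _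
  PrimesBelow = subsetSetoid (λ P → IsPrimeIdeal R P × P ⊆ 𝔪)

  -- Together with `num~den*x`: a fraction and its numerator are multiples of each other, so an
  -- ideal of the localization contains both or neither.
  x~den⁻¹*num : ∀ x → x ~ (1# / den x [ den∈S x ]) R𝔪.* ι (num x)
  x~den⁻¹*num (a / s [ _ ]) = exact
    (solve 2 (λ a s → a :* (s :* con 1) := con 1 :* a :* s) refl a s)

  num~den*x : ∀ x → ι (num x) ~ ι (den x) R𝔪.* x
  num~den*x (a / s [ _ ]) = exact
    (solve 2 (λ a s → a :* (con 1 :* s) := s :* a :* con 1) refl a s)

  module _ {P} (isPrime : IsPrimeIdeal R P) (P⊆𝔪 : P ⊆ 𝔪) where
    open IsPrimeIdeal isPrime

    -- Because `P ⊆ 𝔪`, a factor outside `𝔪` is outside `P`, and primality removes it.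
    cancel-∉𝔪ˡ : ∀ {s x} → s ∉ 𝔪 → s * x ∈ P → x ∈ P
    cancel-∉𝔪ˡ s∉𝔪 = [ (λ s∈P → contradiction (P⊆𝔪 s∈P) s∉𝔪) , (λ x∈P → x∈P) ] ∘ prime

    -- Induction on how `x` is generated. Equality of fractions is a cross-multiplied equation with
    -- extra factors outside `𝔪`; `cancel-∉𝔪ˡ` strips those factors and the denominators.
    extension⇒num∈ : ∀ {x} → x ∈ extension P → num x ∈ P
    extension⇒num∈ {x} (generator (a , a∈P , by u u∉𝔪 e)) =
      resp (*-identityʳ _)
        (cancel-∉𝔪ˡ u∉𝔪 (resp (sym e) (*-closed u (resp (*-comm _ _) (*-closed (den x) a∈P)))))
    extension⇒num∈ {y} (respects {x} (by u u∉𝔪 e) x∈) =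
      cancel-∉𝔪ˡ (den∈S x) (resp (*-comm _ _)
        (cancel-∉𝔪ˡ u∉𝔪 (resp e (*-closed u (resp (*-comm _ _) (*-closed (den y) (extension⇒num∈ x∈)))))))
    extension⇒num∈ null = 0∈
    extension⇒num∈ (sum {x} {y} x∈ y∈) = +-closed
      (resp (*-comm _ _) (*-closed (den y) (extension⇒num∈ x∈)))
      (resp (*-comm _ _) (*-closed (den x) (extension⇒num∈ y∈)))
    extension⇒num∈ (multiple r x∈) = *-closed (num r) (extension⇒num∈ x∈)

    num∈⇒extension : ∀ {x} → num x ∈ P → x ∈ extension P
    num∈⇒extension {x} a∈P = respects (R𝔪.sym (x~den⁻¹*num x))
      (multiple (1# / den x [ den∈S x ]) (generator (num x , a∈P , R𝔪.refl)))

    extension-isPrime : IsPrimeIdeal Localization (extension P)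
    extension-isPrime = record
      { isIdeal = record
        { resp     = respects
        ; 0∈       = null
        ; +-closed = sum
        ; *-closed = multiple
        }
      ; 1∉    = 1∉ ∘ extension⇒num∈
      ; prime = Sum.map num∈⇒extension num∈⇒extension ∘ prime ∘ extension⇒num∈
      }

  extension-mono : ∀ {P P′} → P ⊆ P′ → extension P ⊆ extension P′
  extension-mono P⊆P′ (generator (a , a∈P , e)) = generator (a , P⊆P′ a∈P , e)
  extension-mono P⊆P′ (respects e x∈)           = respects e (extension-mono P⊆P′ x∈)
  extension-mono P⊆P′ null                      = null
  extension-mono P⊆P′ (sum x∈ y∈)               = sum (extension-mono P⊆P′ x∈) (extension-mono P⊆P′ y∈)
  extension-mono P⊆P′ (multiple r x∈)           = multiple r (extension-mono P⊆P′ x∈)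

  extension-reflects-⊆ : ∀ {P P′} → IsPrimeIdeal R P′ → P′ ⊆ 𝔪 → extension P ⊆ extension P′ → P ⊆ P′
  extension-reflects-⊆ isPrime P′⊆𝔪 E⊆E′ {a} a∈P =
    extension⇒num∈ isPrime P′⊆𝔪 (E⊆E′ (generator (a , a∈P , R𝔪.refl)))

  contraction : Pred Fraction 0ℓ → Pred Carrier 0ℓ
  contraction Q a = ι a ∈ Q

  module _ {Q} (isPrime : IsPrimeIdeal Localization Q) where
    open IsPrimeIdeal isPrime

    contraction-isPrime : IsPrimeIdeal R (contraction Q)
    contraction-isPrime = record
      { isIdeal = record
        { resp     = λ a≈b → resp (exact (*-congʳ a≈b))
        ; 0∈       = 0∈
        ; +-closed = λ {a} {b} a∈ b∈ → resp (exact (lemma₁ a b)) (+-closed a∈ b∈)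
        ; *-closed = λ r {a} a∈ → resp (exact (lemma₂ r a)) (*-closed (ι r) a∈)
        }
      ; 1∉    = 1∉
      ; prime = λ {a} {b} ab∈ → prime (resp (R𝔪.sym (exact (lemma₂ a b))) ab∈)
      }
      where
      lemma₁ : ∀ a b → (a * 1# + b * 1#) * 1# ≈ (a + b) * (1# * 1#)
      lemma₁ = solve 2 (λ a b → (a :* con 1 :+ b :* con 1) :* con 1 := (a :+ b) :* (con 1 :* con 1)) refl
      lemma₂ : ∀ a b → a * b * 1# ≈ a * b * (1# * 1#)
      lemma₂ = solve 2 (λ a b → a :* b :* con 1 := a :* b :* (con 1 :* con 1)) refl

    -- An `s` outside `𝔪` has inverse `1# / s` in the localization, so `ι s ∈ Q` would force
    -- `1 ∈ Q`. This only refutes `s ∉ 𝔪`, whence the appeal to `𝔪-stable`.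
    contraction⊆𝔪 : contraction Q ⊆ 𝔪
    contraction⊆𝔪 {s} s∈ = 𝔪-stable (λ s∉𝔪 → 1∉ (resp
      (exact (solve 1 (λ s → con 1 :* s :* con 1 := con 1 :* (s :* con 1)) refl s))
      (*-closed (1# / s [ s∉𝔪 ]) s∈)))

    extension-contraction : extension (contraction Q) ≐ Q
    extension-contraction =
      (λ {x} x∈ → resp (R𝔪.sym (x~den⁻¹*num x))
        (*-closed (1# / den x [ den∈S x ]) (extension⇒num∈ contraction-isPrime contraction⊆𝔪 x∈)))
      , (λ {x} x∈ → num∈⇒extension contraction-isPrime contraction⊆𝔪
          (resp (R𝔪.sym (num~den*x x)) (*-closed (ι (den x)) x∈)))

  extension-bijection : Bijection PrimesBelow (PrimeIdeals Localization)
  extension-bijection = record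
    { to   = λ (P , isPrime , P⊆𝔪) → extension P , extension-isPrime isPrime P⊆𝔪
    ; cong = λ {(P , _)} {(P′ , _)} → cong {P} {P′}
    ; bijective =
        (λ {(_ , p , P⊆𝔪)} {(_ , p′ , P′⊆𝔪)} (E⊆E′ , E′⊆E) →
          extension-reflects-⊆ p′ P′⊆𝔪 E⊆E′ , extension-reflects-⊆ p P⊆𝔪 E′⊆E)
      , (λ (Q , q) → (contraction Q , contraction-isPrime q , contraction⊆𝔪 q)
          , λ {(P , _)} e → ≐-trans (cong {P} e) (extension-contraction q))
    }
    where
    cong : ∀ {P P′} → P ≐ P′ → extension P ≐ extension P′
    cong (P⊆P′ , P′⊆P) = extension-mono P⊆P′ , extension-mono P′⊆P

  -- A coefficient outside `𝔪` becomes invertible, so each of the two relations between numerators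
  -- turns into a divisibility of fractions.
  localization-total :
    (∀ f g → (∃[ a ] ∃[ b ] a ∉ 𝔪 × a * g ≈ b * f) ⊎ (∃[ a ] ∃[ b ] a ∉ 𝔪 × a * f ≈ b * g)) →
    DivisibilityTotal Localization
  localization-total total x y = Sum.map (quotient x y) (quotient y x) (total (num x) (num y))
    where
    quotient : ∀ x y → ∃[ a ] ∃[ b ] a ∉ 𝔪 × a * num y ≈ b * num x → ∃[ r ] y R𝔪.≈ r R𝔪.* x
    quotient (f / s [ _ ]) (g / t [ t∉𝔪 ]) (a , b , a∉𝔪 , ag≈bf) =
      -- Formally `g / f = b / a`, so `(g / t) / (f / s) = (b * s) / (a * t)`.
      (b * s) / (a * t) [ IsMultiplicative.*-closed mult a∉𝔪 t∉𝔪 ] , exact (begin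
        g * (a * t * s)      ≈⟨ solve 4 (λ g a t s → g :* (a :* t :* s) := a :* g :* (s :* t)) refl g a t s ⟩
        a * g * (s * t)      ≈⟨ *-congʳ ag≈bf ⟩
        b * f * (s * t)      ≈⟨ solve 4 (λ b f s t → b :* f :* (s :* t) := b :* s :* f :* t) refl b f s t ⟩
        b * s * f * t        ∎)
      where open SetoidReasoning setoid

-- Primes of a valuation domain

module ValuationDomain
  (em : ExcludedMiddle 0ℓ) (D : CommutativeRing 0ℓ 0ℓ) (dom : IsIntegralDomain D)
  (total : DivisibilityTotal D) where
  open CommutativeRing D
  open IsIntegralDomain dom
  open Valuation D dom
  open Frac using (ι; by; exact)
  open Subsemigroups Γ _≤_ S
  open SemiringSolver commutativeSemiring
  private
    module K = CommutativeRing FractionField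
    module K^× = AbelianGroup K^×
    module Γ = AbelianGroup Γ

  -- Values of nonzero elements and divisibility

  _*≉0_ : ∀ {a b} → a ∈ NonZero D → b ∈ NonZero D → a * b ∈ NonZero D
  _*≉0_ = IsMultiplicative.*-closed (nonZero-isMultiplicative D dom)

  ≉0-resp : ∀ {a b} → a ≈ b → b ∈ NonZero D → a ∈ NonZero D
  ≉0-resp a≈b b≉0 a≈0 = b≉0 (trans (sym a≈b) a≈0)

  val : ∀ a → a ∈ NonZero D → Γ.Carrier
  val a a≉0 = ν (ι a) (ι-nonZero a≉0)

  ι-* : ∀ a b → ι a K.* ι b K.≈ ι (a * b)
  ι-* a b = exact (solve 2 (λ a b → a :* b :* con 1 := a :* b :* (con 1 :* con 1)) refl a b)

  -- Order and equality in `Γ` both say that a quotient in `K^×` comes from `D`, in the case of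
  -- equality from a unit. This lemma and its converse translate such statements into divisibility
  -- in `D`.
  val-quotient⇒ : ∀ {a b r} (a≉0 : a ∈ NonZero D) (b≉0 : b ∈ NonZero D) →
    proj₁ (val b b≉0 K^×.∙ val a a≉0 K^×.⁻¹) K.≈ ι r → b ≈ r * a
  val-quotient⇒ {a} {b} {r} _ _ (by c c≉0 e) = begin
    b             ≈⟨ solve 1 (λ b → b := b :* con 1 :* con 1) refl b ⟩
    b * 1# * 1#   ≈⟨ *-cancelˡ-nonZero D dom c≉0 e ⟩
    r * (1# * a)  ≈⟨ *-congˡ (*-identityˡ a) ⟩
    r * a         ∎
    where open SetoidReasoning setoid

  val-quotient⇐ : ∀ {a b r} (a≉0 : a ∈ NonZero D) (b≉0 : b ∈ NonZero D) →
    b ≈ r * a → proj₁ (val b b≉0 K^×.∙ val a a≉0 K^×.⁻¹) K.≈ ι r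
  val-quotient⇐ {a} {b} {r} _ _ b≈ra = exact (begin
    b * 1# * 1#   ≈⟨ solve 1 (λ b → b :* con 1 :* con 1 := b) refl b ⟩
    b             ≈⟨ b≈ra ⟩
    r * a         ≈⟨ *-congˡ (*-identityˡ a) ⟨
    r * (1# * a)  ∎)
    where open SetoidReasoning setoid

  val-≈⇒associated : ∀ {a b} (a≉0 : a ∈ NonZero D) (b≉0 : b ∈ NonZero D) →
    val a a≉0 Γ.≈ val b b≉0 → ∃[ u ] b ≈ u * a
  val-≈⇒associated a≉0 b≉0 (u , _ , e) = u , val-quotient⇒ a≉0 b≉0 e

  val-cong : ∀ {a b} (a≉0 : a ∈ NonZero D) (b≉0 : b ∈ NonZero D) → a ≈ b → val a a≉0 Γ.≈ val b b≉0
  val-cong a≉0 b≉0 a≈b = 1# , (1# , *-identityʳ 1#)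
    , val-quotient⇐ a≉0 b≉0 (trans (sym a≈b) (sym (*-identityˡ _)))

  K^×-≈⇒≈ : ∀ {x y} → x K^×.≈ y → x Γ.≈ y
  K^×-≈⇒≈ {x} {y} x≈y = 1# , (1# , *-identityʳ 1#)
    , K^×.trans {y K^×.∙ x K^×.⁻¹} {x K^×.∙ x K^×.⁻¹} {K^×.ε}
        (K^×.∙-congʳ {x K^×.⁻¹} {y} {x} (K^×.sym {x} {y} x≈y)) (K^×.inverseʳ x)

  val-* : ∀ {a b} (a≉0 : a ∈ NonZero D) (b≉0 : b ∈ NonZero D) →
    val a a≉0 Γ.∙ val b b≉0 Γ.≈ val (a * b) (a≉0 *≉0 b≉0)
  val-* {a} {b} a≉0 b≉0 =
    K^×-≈⇒≈ {val a a≉0 K^×.∙ val b b≉0} {val (a * b) (a≉0 *≉0 b≉0)} (ι-* a b)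

  power≉0 : ∀ {a} → a ∈ NonZero D → ∀ n → power *-rawMonoid n a ∈ NonZero D
  power≉0 a≉0 ℕ.zero    = 1≉0
  power≉0 a≉0 (ℕ.suc n) = a≉0 *≉0 power≉0 a≉0 n

  val-power : ∀ {a} (a≉0 : a ∈ NonZero D) n →
    val a a≉0 ^ n Γ.≈ val (power *-rawMonoid n a) (power≉0 a≉0 n)
  val-power a≉0 ℕ.zero    = Γ.refl {val 1# 1≉0}
  val-power {a} a≉0 (ℕ.suc n) = Γ.trans {x ^ ℕ.suc n} {x Γ.∙ y} {z}
    (Γ.∙-congˡ {x} {x ^ n} {y} (val-power a≉0 n)) (val-* a≉0 (power≉0 a≉0 n))
    where
    x = val a a≉0
    y = val (power *-rawMonoid n a) (power≉0 a≉0 n)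
    z = val (power *-rawMonoid (ℕ.suc n) a) (power≉0 a≉0 (ℕ.suc n))

  ^-cong : ∀ {x y} n → x Γ.≈ y → x ^ n Γ.≈ y ^ n
  ^-cong         ℕ.zero    x≈y = Γ.refl {Γ.ε}
  ^-cong {x} {y} (ℕ.suc n) x≈y = Γ.∙-cong {x} {y} {x ^ n} {y ^ n} x≈y (^-cong n x≈y)

  ≤-reflexive : ∀ {x y} → x Γ.≈ y → x ≤ y
  ≤-reflexive (u , _ , e) = u , e

  ≤-trans : ∀ {x y z} → x ≤ y → y ≤ z → x ≤ z
  ≤-trans {x , x≉0} {y , y≉0} {z , _} (r , e) (s , f) = s * r , (begin
    z K.* x⁻¹                    ≈⟨ K.*-congˡ {z} (K.*-identityˡ x⁻¹) ⟨
    z K.* (K.1# K.* x⁻¹)         ≈⟨ K.*-congˡ {z} (K.*-congʳ {x⁻¹} (K^×.inverseˡ (y , y≉0))) ⟨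
    z K.* (y⁻¹ K.* y K.* x⁻¹)    ≈⟨ K.*-congˡ {z} (K.*-assoc y⁻¹ y x⁻¹) ⟩
    z K.* (y⁻¹ K.* (y K.* x⁻¹))  ≈⟨ K.*-assoc z y⁻¹ (y K.* x⁻¹) ⟨
    z K.* y⁻¹ K.* (y K.* x⁻¹)    ≈⟨ K.*-cong f e ⟩
    ι s K.* ι r                  ≈⟨ ι-* s r ⟩
    ι (s * r)                    ∎)
    where
    open SetoidReasoning K.setoid
    x⁻¹ = proj₁ ((x , x≉0) K^×.⁻¹)
    y⁻¹ = proj₁ ((y , y≉0) K^×.⁻¹)

  -- Elements of equal value are multiples of each other, so an ideal containing one contains the
  -- other. Nonzero membership in an ideal can thus be read off from values.
  val∈image⇒∈ : ∀ {Q} → IsIdeal D Q → ∀ {b} (b≉0 : b ∈ NonZero D) → val b b≉0 ∈ image Q → b ∈ Q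
  val∈image⇒∈ isIdeal {b} b≉0 (a , a≉0 , a∈Q , a≈b) =
    let u , b≈ua = val-≈⇒associated a≉0 b≉0 a≈b
    in IsIdeal.resp isIdeal (sym b≈ua) (IsIdeal.*-closed isIdeal u a∈Q)

  ∈⇒val∈image : ∀ {Q b} (b≉0 : b ∈ NonZero D) → b ∈ Q → val b b≉0 ∈ image Q
  ∈⇒val∈image {b = b} b≉0 b∈Q = b , b≉0 , b∈Q , Γ.refl {val b b≉0}

  image-resp : ∀ {Q x y} → x Γ.≈ y → x ∈ image Q → y ∈ image Q
  image-resp {x = x} {y} x≈y (a , a≉0 , a∈Q , e) =
    a , a≉0 , a∈Q , Γ.trans {val a a≉0} {x} {y} e x≈y

  image-mono : ∀ {Q Q′} → Q ⊆ Q′ → image Q ⊆ image Q′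
  image-mono Q⊆Q′ (a , a≉0 , a∈Q , e) = a , a≉0 , Q⊆Q′ a∈Q , e

  -- Zero has no value, so it is split off by excluded middle; every ideal contains it.
  image-reflects-⊆ : ∀ {Q Q′} → IsIdeal D Q′ → image Q ⊆ image Q′ → Q ⊆ Q′
  image-reflects-⊆ {Q} isIdeal V⊆V′ {a} a∈Q with em {a ≈ 0#}
  ... | yes a≈0 = IsIdeal.resp isIdeal (sym a≈0) (IsIdeal.0∈ isIdeal)
  ... | no  a≉0 = val∈image⇒∈ isIdeal a≉0 (V⊆V′ {val a a≉0} (∈⇒val∈image {Q} a≉0 a∈Q))

  module _ {Q} (isPrime : IsPrimeIdeal D Q) where
    open IsPrimeIdeal isPrime

    -- Representatives `a` of `x` and `b` of `y` satisfy `val a ≤ val b`, so `a` divides `b` and `b`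
    -- lies in `Q`. Both convexity and the absence of a right end point follow.
    image-upward : ∀ {x y} → x ∈ image Q → y ∈ S → x ≤ y → y ∈ image Q
    image-upward {x} {y} (a , a≉0 , a∈Q , a≈x) (b , b≉0 , _ , b≈y) x≤y =
      let r , e = ≤-trans {val a a≉0} {x} {val b b≉0} (≤-reflexive {val a a≉0} {x} a≈x)
                    (≤-trans {x} {y} {val b b≉0} x≤y
                      (≤-reflexive {y} {val b b≉0} (Γ.sym {val b b≉0} {y} b≈y)))
      in b , b≉0 , resp (sym (val-quotient⇒ a≉0 b≉0 e)) (*-closed r a∈Q) , b≈y

    image-isProperRadical : IsProperRadicalWithoutRightEndPoint (image Q)
    image-isProperRadical = record
      { isSubsemigroup = record
        { resp     = λ {x} {y} → image-resp {Q} {x} {y}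
        ; T⊆S      = λ (a , a≉0 , _ , a≈x) → a , a≉0 , _ , a≈x
        ; ∙-closed = λ {x} {y} (a , a≉0 , a∈Q , a≈x) (b , b≉0 , b∈Q , b≈y) →
            image-resp {Q} {val a a≉0 Γ.∙ val b b≉0} {x Γ.∙ y}
              (Γ.∙-cong {val a a≉0} {x} {val b b≉0} {y} a≈x b≈y)
              (a * b , (a≉0 *≉0 b≉0) , *-closed a b∈Q
                , Γ.sym {val a a≉0 Γ.∙ val b b≉0} {val (a * b) (a≉0 *≉0 b≉0)} (val-* a≉0 b≉0))
        }
      -- If `Q` attained every value, it would attain that of `1#` and hence contain `1#`.
      ; proper  = λ (_ , S⊆T) → 1∉ (val∈image⇒∈ isIdeal 1≉0 (S⊆T {val 1# 1≉0} (∈⇒val∈image {b = 1#} 1≉0 _)))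
      -- For a representative `b` of `y`, the power `b ^ n` has value `x` and so lies in `Q`;
      -- primality then gives `b ∈ Q`.
      ; radical = λ { {x} {y} n x∈T _ (b , b≉0 , _ , b≈y) yⁿ≈x →
          let bⁿ = val (power *-rawMonoid n b) (power≉0 b≉0 n)
              x≈bⁿ = Γ.trans {x} {y ^ n} {bⁿ} (Γ.sym {y ^ n} {x} yⁿ≈x)
                (Γ.trans {y ^ n} {val b b≉0 ^ n} {bⁿ}
                  (^-cong n (Γ.sym {val b b≉0} {y} b≈y)) (val-power b≉0 n))
          in b , b≉0
            , power∈⇒∈ isPrime n (val∈image⇒∈ isIdeal (power≉0 b≉0 n) (image-resp {Q} {x} {bⁿ} x≈bⁿ x∈T))
            , b≈y }
      ; withoutRightEndPoint =
          (λ {t₁} {_} {s} t₁∈T _ s∈S (t₁≤s , _) _ → image-upward {t₁} {s} t₁∈T s∈S t₁≤s)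
        , (λ {x} {y} x∈T y∈S (x≤y , _) → image-upward {x} {y} x∈T y∈S x≤y)
      }

  -- The set of all `a` that are zero or have value in `T`, encoded as an implication: zero belongs
  -- vacuously, and no case distinction has to be stored.
  preimage : Pred Γ.Carrier 0ℓ → Pred Carrier 0ℓ
  preimage T a = ∀ (a≉0 : a ∈ NonZero D) → val a a≉0 ∈ T

  module _ {T} (isPR : IsProperRadicalWithoutRightEndPoint T) where
    open IsProperRadicalWithoutRightEndPoint isPR
    open IsSubsemigroup isSubsemigroup

    -- The end-point condition speaks of strict inequality; the case of equal values is split off by
    -- excluded middle and settled by `resp`.
    upward : ∀ {x y} → x ∈ T → y ∈ S → x ≤ y → y ∈ T
    upward {x} {y} x∈T y∈S x≤y with em {x Γ.≈ y}
    ... | yes x≈y = resp {x} {y} x≈y x∈T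
    ... | no  x≉y = proj₂ withoutRightEndPoint {x} {y} x∈T y∈S (x≤y , x≉y)

    preimage-resp : ∀ {a b} → a ≈ b → a ∈ preimage T → b ∈ preimage T
    preimage-resp {a} {b} a≈b a∈ b≉0 =
      resp {val a a≉0} {val b b≉0} (val-cong a≉0 b≉0 a≈b) (a∈ a≉0)
      where a≉0 = ≉0-resp a≈b b≉0

    preimage-* : ∀ r {a} → a ∈ preimage T → r * a ∈ preimage T
    preimage-* r {a} a∈ ra≉0 =
      upward {val a a≉0} {val (r * a) ra≉0} (a∈ a≉0) (∈⇒val∈image {b = r * a} ra≉0 _)
        (r , val-quotient⇐ a≉0 ra≉0 refl)
      where
      a≉0 : a ∈ NonZero D
      a≉0 a≈0 = ra≉0 (trans (*-congˡ a≈0) (zeroʳ r))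

    -- One summand divides the other, so the sum is a multiple of one of them and `preimage-*`
    -- applies.
    preimage-+ : ∀ {a b} → a ∈ preimage T → b ∈ preimage T → a + b ∈ preimage T
    preimage-+ {a} {b} a∈ b∈ with total a b
    ... | inj₁ (r , b≈ra) = preimage-resp (sym (begin
      a + b         ≈⟨ +-congˡ b≈ra ⟩
      a + r * a     ≈⟨ solve 2 (λ a r → a :+ r :* a := (con 1 :+ r) :* a) refl a r ⟩
      (1# + r) * a  ∎)) (preimage-* (1# + r) a∈)
      where open SetoidReasoning setoid
    ... | inj₂ (r , a≈rb) = preimage-resp (sym (begin
      a + b         ≈⟨ +-congʳ a≈rb ⟩
      r * b + b     ≈⟨ solve 2 (λ b r → r :* b :+ b := (r :+ con 1) :* b) refl b r ⟩
      (r + 1#) * b  ∎)) (preimage-* (r + 1#) b∈)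
      where open SetoidReasoning setoid

    preimage-square : ∀ {a} → a * a ∈ preimage T → a ∈ preimage T
    preimage-square {a} aa∈ a≉0 =
      -- The second power unfolds to `a * (a * 1#)`, which accounts for the trailing `1#`.
      radical {val (a * (a * 1#)) aa1≉0} {val a a≉0} 2
        (preimage-resp (*-congˡ (sym (*-identityʳ a))) aa∈ aa1≉0)
        (s≤s z≤n) (∈⇒val∈image {b = a} a≉0 _) (val-power a≉0 2)
      where aa1≉0 = power≉0 a≉0 2

    preimage-isPrime : IsPrimeIdeal D (preimage T)
    preimage-isPrime = record
      { isIdeal = record
        { resp     = preimage-resp
        ; 0∈       = λ 0≉0 → contradiction refl 0≉0
        ; +-closed = preimage-+
        ; *-closed = preimage-*
        }
      -- With `1#`, every multiple `b * 1#` would lie in the preimage, so `T` would be all of `S`.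
      ; 1∉    = λ 1∈ → proper (T⊆S , λ { {y} (b , b≉0 , _ , b≈y) →
          resp {val b b≉0} {y} b≈y (preimage-resp (*-identityʳ b) (preimage-* b 1∈) b≉0) })
      ; prime = λ {a} {b} ab∈ → [ (λ (r , b≈ra) → inj₂ (factor ab∈ b≈ra))
          , (λ (r , a≈rb) → inj₁ (factor (preimage-resp (*-comm a b) ab∈) a≈rb)) ]′ (total a b)
      }
      where
      -- Since `b ≈ r * a`, the square `b * b` is the multiple `r * (a * b)`, and radicality
      -- extracts the root.
      factor : ∀ {a b r} → a * b ∈ preimage T → b ≈ r * a → b ∈ preimage T
      factor {a} {b} {r} ab∈ b≈ra = preimage-square (preimage-resp
        (trans (sym (*-assoc r a b)) (*-congʳ (sym b≈ra))) (preimage-* r ab∈))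

    image-preimage : image (preimage T) ≐ T
    image-preimage =
      (λ { {y} (a , a≉0 , a∈ , a≈y) → resp {val a a≉0} {y} a≈y (a∈ a≉0) })
      , λ {x} x∈T → preserve x x∈T (T⊆S x∈T)
      where
      preserve : ∀ x → x ∈ T → x ∈ S → x ∈ image (preimage T)
      preserve x x∈T (a , a≉0 , _ , a≈x) = a , a≉0
        -- The value of `a` does not depend on the proof that `a` is nonzero, so `a≈x` also serves
        -- for `a≉0′`.
        , (λ a≉0′ → resp {x} {val a a≉0′} (Γ.sym {val a a≉0′} {x} a≈x) x∈T) , a≈x

  image-bijection : Bijection (PrimeIdeals D) (subsetSetoid IsProperRadicalWithoutRightEndPoint)
  image-bijection = record
    { to   = λ (Q , q) → image Q , image-isProperRadical q
    ; cong = λ {(Q , _)} {(Q′ , _)} → cong {Q} {Q′}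
    ; bijective =
        (λ {(_ , q)} {(_ , q′)} (V⊆V′ , V′⊆V) →
          image-reflects-⊆ (IsPrimeIdeal.isIdeal q′) (λ {x} → V⊆V′ {x})
          , image-reflects-⊆ (IsPrimeIdeal.isIdeal q) (λ {x} → V′⊆V {x}))
      , (λ (T , t) → (preimage T , preimage-isPrime t)
          , λ {(Q , _)} e → ≐-trans (cong {Q} e) (image-preimage t))
    }
    where
    cong : ∀ {Q Q′} → Q ≐ Q′ → image Q ≐ image Q′
    cong (Q⊆Q′ , Q′⊆Q) = (λ {x} → image-mono Q⊆Q′ {x}) , (λ {x} → image-mono Q′⊆Q {x})

-- The valuation property of *ℤ_𝔪

-- The quotient acts as the sign of `i`: it converts coefficients of the absolute value into
-- coefficients of `i`.
i∣+∣i∣ : ∀ i → i ℤ∣.∣ + ℤ.∣ i ∣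
i∣+∣i∣ i = ℤ∣.∣ᵤ⇒∣ ℕ∣.∣-refl

bézout-ℤ : ∀ m n → ∃[ d ] d ℤ∣.∣ m × d ℤ∣.∣ n × ∃[ x ] ∃[ y ] x ℤ.* m ℤ.+ y ℤ.* n ≡ d
bézout-ℤ m n with Bézout.lemma ℤ.∣ m ∣ ℤ.∣ n ∣
... | Bézout.result d gcd identity =
  + d , ℤ∣.∣ᵤ⇒∣ (GCD.gcd∣m gcd) , ℤ∣.∣ᵤ⇒∣ (GCD.gcd∣n gcd) , signed identity
  where
  open ≡.≡-Reasoning
  open ℤ∣._∣_ (i∣+∣i∣ m) renaming (quotient to s; equality to ∣m∣≡s*m)
  open ℤ∣._∣_ (i∣+∣i∣ n) renaming (quotient to t; equality to ∣n∣≡t*n)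

  difference : ∀ {i j} x y → d ℕ.+ y ℕ.* j ≡ x ℕ.* i → + d ≡ + x ℤ.* + i ℤ.- + y ℤ.* + j
  difference {i} {j} x y eq = begin
    + d                                        ≡⟨ lemma (+ d) (+ y ℤ.* + j) ⟩
    + d ℤ.+ + y ℤ.* + j ℤ.- + y ℤ.* + j        ≡⟨ ≡.cong (λ z → + d ℤ.+ z ℤ.- + y ℤ.* + j) (ℤ.pos-* y j) ⟨
    + d ℤ.+ + (y ℕ.* j) ℤ.- + y ℤ.* + j        ≡⟨ ≡.cong (ℤ._- + y ℤ.* + j) (ℤ.pos-+ d (y ℕ.* j)) ⟨
    + (d ℕ.+ y ℕ.* j) ℤ.- + y ℤ.* + j          ≡⟨ ≡.cong (λ z → + z ℤ.- + y ℤ.* + j) eq ⟩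
    + (x ℕ.* i) ℤ.- + y ℤ.* + j                ≡⟨ ≡.cong (ℤ._- + y ℤ.* + j) (ℤ.pos-* x i) ⟩
    + x ℤ.* + i ℤ.- + y ℤ.* + j                ∎
    where
    lemma : ∀ a b → a ≡ a ℤ.+ b ℤ.- b
    lemma = solve-∀

  -- Over the natural numbers Bézout's identity avoids subtraction and so has two orientations. Each
  -- is rewritten as a difference, and the signs `s` and `t` are absorbed into the coefficients.
  signed : Bézout.Identity d ℤ.∣ m ∣ ℤ.∣ n ∣ → ∃[ x ] ∃[ y ] x ℤ.* m ℤ.+ y ℤ.* n ≡ + d
  signed (Bézout.+- x y eq) = + x ℤ.* s , ℤ.- (+ y ℤ.* t) , (begin
    + x ℤ.* s ℤ.* m ℤ.+ ℤ.- (+ y ℤ.* t) ℤ.* n       ≡⟨ lemma (+ x) s m (+ y) t n ⟩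
    + x ℤ.* (s ℤ.* m) ℤ.- + y ℤ.* (t ℤ.* n)         ≡⟨ ≡.cong₂ (λ i j → + x ℤ.* i ℤ.- + y ℤ.* j)
                                                         ∣m∣≡s*m ∣n∣≡t*n ⟨
    + x ℤ.* + ℤ.∣ m ∣ ℤ.- + y ℤ.* + ℤ.∣ n ∣         ≡⟨ difference x y eq ⟨
    + d                                             ∎)
    where
    lemma : ∀ x s m y t n → x ℤ.* s ℤ.* m ℤ.+ ℤ.- (y ℤ.* t) ℤ.* n ≡ x ℤ.* (s ℤ.* m) ℤ.- y ℤ.* (t ℤ.* n)
    lemma = solve-∀
  signed (Bézout.-+ x y eq) = ℤ.- (+ x ℤ.* s) , + y ℤ.* t , (begin
    ℤ.- (+ x ℤ.* s) ℤ.* m ℤ.+ + y ℤ.* t ℤ.* n       ≡⟨ lemma (+ x) s m (+ y) t n ⟩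
    + y ℤ.* (t ℤ.* n) ℤ.- + x ℤ.* (s ℤ.* m)         ≡⟨ ≡.cong₂ (λ i j → + y ℤ.* j ℤ.- + x ℤ.* i)
                                                         ∣m∣≡s*m ∣n∣≡t*n ⟨
    + y ℤ.* + ℤ.∣ n ∣ ℤ.- + x ℤ.* + ℤ.∣ m ∣         ≡⟨ difference y x eq ⟨
    + d                                             ∎)
    where
    lemma : ∀ x s m y t n → ℤ.- (x ℤ.* s) ℤ.* m ℤ.+ y ℤ.* t ℤ.* n ≡ y ℤ.* (t ℤ.* n) ℤ.- x ℤ.* (s ℤ.* m)
    lemma = solve-∀

-- The ratio `n : m` in lowest terms `b : a`. Coprimality is kept as a Bézout equation, because
-- equations pass coordinatewise to the ultrapower.
record CoprimeRatio (m n : ℤ) : Set where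
  field
    a b x y    : ℤ
    proportion : a ℤ.* n ≡ b ℤ.* m
    coprime    : x ℤ.* a ℤ.+ y ℤ.* b ≡ 1ℤ

coprimeRatio : ∀ m n → CoprimeRatio m n
coprimeRatio m n with bézout-ℤ m n
... | d , ℤ∣.divides a ≡.refl , ℤ∣.divides b ≡.refl , x , y , eq with d ℤ.≟ 0ℤ
-- Here `m` and `n` both vanish, every pair is proportional to them, and the coprime pair `1ℤ`, `0ℤ`
-- is chosen.
...   | yes ≡.refl = record
  { a = 1ℤ ; b = 0ℤ ; x = 1ℤ ; y = 0ℤ
  ; proportion = ≡.trans (ℤ.*-identityˡ (b ℤ.* 0ℤ)) (ℤ.*-zeroʳ b)
  ; coprime    = ≡.refl
  }
...   | no d≢0 = record
  { a = a ; b = b ; x = x ; y = y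
  ; proportion = lemma₁ a b d
  -- Bézout's identity for `m = a * d` and `n = b * d`, divided by the nonzero `d`.
  ; coprime    = ℤ.*-cancelˡ-≡ d _ _ {{ℤ.≢-nonZero d≢0}} (begin
      d ℤ.* (x ℤ.* a ℤ.+ y ℤ.* b)          ≡⟨ lemma₂ a b x y d ⟩
      x ℤ.* (a ℤ.* d) ℤ.+ y ℤ.* (b ℤ.* d)  ≡⟨ eq ⟩
      d                                    ≡⟨ ℤ.*-identityʳ d ⟨
      d ℤ.* 1ℤ                             ∎)
  }
  where
  open ≡.≡-Reasoning
  lemma₁ : ∀ a b d → a ℤ.* (b ℤ.* d) ≡ b ℤ.* (a ℤ.* d)
  lemma₁ = solve-∀
  lemma₂ : ∀ a b x y d → d ℤ.* (x ℤ.* a ℤ.+ y ℤ.* b) ≡ x ℤ.* (a ℤ.* d) ℤ.+ y ℤ.* (b ℤ.* d)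
  lemma₂ = solve-∀

module _ (em : ExcludedMiddle 0ℓ) {I : Set} (𝒰 : Ultrafilter I) where
  open Ultrafilter 𝒰 using (all; upward)
  open CommutativeRing (Ultrapower 𝒰)

  -- Coprime ratios are chosen in each coordinate. The resulting `a` and `b` satisfy
  -- `x * a + y * b ≈ 1#`, so a proper ideal misses at least one of them; excluded middle decides
  -- which to use as the coefficient.
  ultrapower-ratio : ∀ {P} → IsIdeal (Ultrapower 𝒰) P → 1# ∉ P → ∀ f g →
    (∃[ a ] ∃[ b ] a ∉ P × a * g ≈ b * f) ⊎ (∃[ a ] ∃[ b ] a ∉ P × a * f ≈ b * g)
  ultrapower-ratio {P} isIdeal 1∉P f g = choose em
    where
    -- Opening this parametrised module makes `a`, `b`, `x`, `y` functions on `I`, that is, elements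
    -- of the ultrapower.
    module Ratio (i : I) = CoprimeRatio (coprimeRatio (f i) (g i))
    open Ratio
    open IsIdeal isIdeal

    b∉P : a ∈ P → b ∉ P
    b∉P a∈P b∈P = 1∉P (resp {x * a + y * b} {1#} (upward (λ {i} _ → coprime i) all)
      (+-closed {x * a} {y * b} (*-closed x a∈P) (*-closed y b∈P)))

    choose : Dec (a ∈ P) →
      (∃[ a ] ∃[ b ] a ∉ P × a * g ≈ b * f) ⊎ (∃[ a ] ∃[ b ] a ∉ P × a * f ≈ b * g)
    choose (no  a∉P) = inj₁ (a , b , a∉P , upward (λ {i} _ → proportion i) all)
    choose (yes a∈P) = inj₂ (b , a , b∉P a∈P , upward (λ {i} _ → ≡.sym (proportion i)) all)

-- The correspondence for primes below `𝔪`

theorem4p14 : ExcludedMiddle 0ℓ →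
    {I : Set} → I ⤖ ℕ →
    (𝒰 : Ultrafilter I) → ¬ Principal 𝒰 →
    (𝔪 : Pred (CommutativeRing.Carrier (Ultrapower 𝒰)) 0ℓ) →
    (𝔪-max : IsMaximalIdeal (Ultrapower 𝒰) 𝔪) →
    let open AtMaximalIdeal 𝒰 𝔪-max in
    Σ[ Φ ∈ Bijection PrimesBelow𝔪 ProperRadicalSubsemigroupsWithoutRightEndPoint ]
      (∀ P → proj₁ (Bijection.to Φ P) ≐ valuesOf (proj₁ P))
theorem4p14 em _ 𝒰 _ 𝔪 𝔪-max =
  -- The composite sends `P` to `image (L.extension P)`, which is `valuesOf P` by definition.
  Composition.bijection At𝔪.extension-bijection Val.image-bijection , λ _ → ≐-refl
  where
  open AtMaximalIdeal 𝒰 𝔪-max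
  module At𝔪 = LocalizeAt *ℤ (maximal-complement-isMultiplicative *ℤ 𝔪-max) (decidable-stable em)
  module Val = ValuationDomain em *ℤ-𝔪 *ℤ-𝔪-isIntegralDomain
    (At𝔪.localization-total (ultrapower-ratio em 𝒰
      (IsMaximalIdeal.isIdeal 𝔪-max) (IsMaximalIdeal.1∉ 𝔪-max)))
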